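{- Let $t$ and $m$ be positive integers. Then \[\binom{2m+1}{t(m+1)}_{t} - \binom{2m+1}{t(m+1)+1}_t = \binom{2m+2}{t(m+1)}_t - \binom{2m+2}{t(m+1)+1}_t,\] or equivalently, with $\lambda_j = (j, j-1, \ldots, 1)$ for each positive integer $j$, \[c^{t*\lambda_{2m+1}}_{t*\lambda_{2m},\, t*(m+1, m)} = c^{t*\lambda_{2m+2}}_{t*\lambda_{2m+1},\, t*(m+1, m+1)},\] where $\binom{n}{k}_t$ denotes the $t$-binomial coefficient, $c^{\lambda}_{\mu,\nu}$ denotes the Littlewood-Richardson coefficient, and $t*\lambda$ denotes the partition obtained by multiplying every part of $\lambda$ by $t$. (That is, both identities hold, and the two sides of the first equal the corresponding sides of the second.)
   Context: $t$-binomial coefficients: for positive integers $n, t$ and an integer $k$ with $0\le k\le tn$, $\binom{n}{k}_t$ is the coefficient of $x^k$ in $(1+x+x^2+\cdots+x^t)^n$. Stretching: for a partition $\lambda = (\lambda_1,\lambda_2,\ldots)$, $t*\lambda = (t\lambda_1, t\lambda_2, \ldots)$; e.g. $3*(3,2,1) = (9,6,3)$. Littlewood-Richardson coefficients: $c^{\lambda}_{\mu,\nu}$ is the multiplicity of $V^\lambda$ in $V^\mu\otimes V^\nu$, where $V^\mu, V^\nu, V^\lambda$ are irreducible polynomial representations of $GL(N)$ ($N$ at least the number of parts of each partition involved). Equivalently (Littlewood-Richardson rule), $c^{\lambda}_{\mu,\nu}$ is the number of semistandard fillings (weakly increasing along rows, strictly increasing down columns) of the skew shape $\lambda/\mu$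 with content $\nu$ (exactly $\nu_i$ entries equal to $i$ for each $i$) such that the word obtained by reading the rows from top to bottom, each row from right to left, is a ballot word: in every initial segment, the number of $a$'s is at least the number of $b$'s whenever $a<b$. -}

module Defs where

open import Data.Bool.Base using (if_then_else_)
open import Data.Fin.Base as Fin using (Fin)
import Data.Fin.Properties as Fin
open import Data.List.Base
  using (List; []; _∷_; map; length; filter; concat; reverse; drop; zip;
         upTo; inits; allFin; lookup; applyDownFrom; cartesianProductWith)
open import Data.List.Relation.Binary.Prefix.Heterogeneous.Properties using (prefix?)
open import Data.List.Relation.Unary.All as All using (All; []; _∷_)
import Data.List.Relation.Unary.All.Properties as All
open import Data.List.Relation.Unary.Linked as Linked using (Linked; []; [-]; _∷_)
import Data.List.Relation.Unary.Linked.Properties as Linked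
open import Data.Nat.Base
open import Data.Nat.ListAction using (sum)
open import Data.Nat.Properties
open import Data.Product.Base using (_×_; _,_; uncurry)
open import Relation.Binary.PropositionalEquality.Core using (_≡_)
open import Relation.Nullary.Decidable using (Dec; ⌊_⌋; _×-dec_; _→-dec_)
open import Relation.Unary using (Decidable)

-- Polynomials with natural-number coefficients, as sequences of coefficients:
-- p k is the coefficient of x^k.  Finite support is not enforced; it holds for
-- the powers of geometric t.

Poly : Set
Poly = ℕ → ℕ

one : Poly
one zero    = 1
one (suc _) = 0

_·_ : Poly → Poly → Poly
(p · q) k = sum (map (λ i → p i * q (k ∸ i)) (upTo (suc k)))

_^ᴾ_ : Poly → ℕ → Poly
p ^ᴾ zero  = one
p ^ᴾ suc n = p · (p ^ᴾ n)

-- 1 + x + ⋯ + x^t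
geometric : ℕ → Poly
geometric t i = if i ≤ᵇ t then 1 else 0

tBinomial : (t n k : ℕ) → ℕ
tBinomial t n k = (geometric t ^ᴾ n) k

-- Trailing zeros are excluded, so containment of Young diagrams is
-- Prefix _≤_ on the parts.

record Partition : Set where
  field
    parts      : List ℕ
    positive   : All NonZero parts
    decreasing : Linked _≥_ parts

open Partition public

infixr 7 _⋆_

_⋆_ : (t : ℕ) .{{_ : NonZero t}} → Partition → Partition
t ⋆ κ = record
  { parts      = map (t *_) (parts κ)
  ; positive   = All.map⁺ (All.map (λ {n} n≢0 → let instance _ = n≢0 in m*n≢0 t n) (positive κ))
  ; decreasing = Linked.map⁺ (Linked.map (*-monoʳ-≤ t) (decreasing κ))
  }

-- (j , j - 1 , … , 1)
staircase : ℕ → Partition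
staircase j = record
  { parts      = applyDownFrom suc j
  ; positive   = All.applyDownFrom⁺₂ suc j (λ _ → _)
  ; decreasing = Linked.applyDownFrom⁺₂ suc j (λ i → n≤1+n (suc i))
  }

twoRow : (a b : ℕ) .{{_ : NonZero b}} → b ≤ a → Partition
twoRow a b b≤a = record
  { parts      = a ∷ b ∷ []
  ; positive   = >-nonZero (<-≤-trans 0<b b≤a) ∷ >-nonZero 0<b ∷ []
  ; decreasing = b≤a ∷ [-]
  }
  where
  0<b : 0 < b
  0<b = >-nonZero⁻¹ b

-- The rows of a skew shape κ/μ with μ contained in κ, from top to bottom: a
-- row (o , n) consists of n boxes, in columns o + 1 , … , o + n.
skewRows : (κ μ : List ℕ) → List (ℕ × ℕ)
skewRows []      _       = []
skewRows (k ∷ κ) []      = (0 , k) ∷ skewRows κ []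
skewRows (k ∷ κ) (m ∷ μ) = (m , k ∸ m) ∷ skewRows κ μ

-- A filling lists, for each row from top to bottom, the column offset of the
-- row and its entries from left to right.  The letter i : Fin r stands for the
-- entry i + 1.
Filling : ℕ → Set
Filling r = List (ℕ × List (Fin r))

words : (r n : ℕ) → List (List (Fin r))
words r zero    = [] ∷ []
words r (suc n) = cartesianProductWith _∷_ (allFin r) (words r n)

fillings : (r : ℕ) → List (ℕ × ℕ) → List (Filling r)
fillings r []               = [] ∷ []
fillings r ((o , n) ∷ rows) =
  cartesianProductWith (λ w T → (o , w) ∷ T) (words r n) (fillings r rows)

module _ {r : ℕ} where

  RowWeak : Filling r → Set
  RowWeak = All (λ (_ , w) → Linked Fin._≤_ w)

  -- Dropping o ∸ o′ entries of the lower row aligns it with the upper one,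
  -- whose offset o is at least o′; zip then discards the columns that meet
  -- only one of the two rows.
  Above : ℕ × List (Fin r) → ℕ × List (Fin r) → Set
  Above (o , w) (o′ , w′) = All (uncurry Fin._<_) (zip w (drop (o ∸ o′) w′))

  ColumnStrict : Filling r → Set
  ColumnStrict = Linked Above

  Semistandard : Filling r → Set
  Semistandard T = RowWeak T × ColumnStrict T

  readingWord : Filling r → List (Fin r)
  readingWord T = concat (map (λ (_ , w) → reverse w) T)

  count : Fin r → List (Fin r) → ℕ
  count i w = length (filter (i Fin.≟_) w)

  Ballot : List (Fin r) → Set
  Ballot w = All (λ u → ∀ a b → a Fin.< b → count b u ≤ count a u) (inits w)

HasContent : (ν : List ℕ) → Filling (length ν) → Set
HasContent ν T = ∀ i → count i (readingWord T) ≡ lookup ν i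

IsLR : (ν : List ℕ) → Filling (length ν) → Set
IsLR ν T = Semistandard T × HasContent ν T × Ballot (readingWord T)

isLR? : ∀ ν → Decidable (IsLR ν)
isLR? ν T = (rowWeak? ×-dec columnStrict?) ×-dec hasContent? ×-dec ballot?
  where
  rowWeak? : Dec (RowWeak T)
  rowWeak? = All.all? (λ (_ , w) → Linked.linked? Fin._≤?_ w) T

  columnStrict? : Dec (ColumnStrict T)
  columnStrict? = Linked.linked? (λ _ _ → All.all? (λ (a , b) → a Fin.<? b) _) T

  hasContent? : Dec (HasContent ν T)
  hasContent? = Fin.all? (λ i → count i (readingWord T) ≟ lookup ν i)

  ballot? : Dec (Ballot (readingWord T))
  ballot? = All.all?
    (λ u → Fin.all? λ a → Fin.all? λ b → (a Fin.<? b) →-dec (count b u ≤? count a u))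
    (inits (readingWord T))

-- c^κ_{μ,ν}, by the Littlewood–Richardson rule (0 unless μ is contained in κ).
-- An entry exceeding the number
-- of parts of ν is excluded by the content, so the alphabet Fin (length ν)
-- suffices.
LR : (κ μ ν : Partition) → ℕ
LR κ μ ν =
  if ⌊ prefix? _≤?_ (parts μ) (parts κ) ⌋
  then length (filter (isLR? (parts ν))
         (fillings (length (parts ν)) (skewRows (parts κ) (parts μ))))
  else 0

{-# OPTIONS --safe #-}

-- The rows of both skew shapes are disjoint horizontal strips of t boxes, so a
-- filling is a choice of the number of 1s in each row, and the ballot condition
-- says that d = #1 − #2 stays nonnegative.  A row with a 1s and t − a 2s sends d
-- to d − t + 2a and is allowed when t − a ≤ d: this is the Clebsch–Gordan rule
-- for tensoring with V_t.  The number of ways to get from d to e in n rows is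
-- therefore given by the reflection principle: with N_n the coefficients of
-- (x^(-t) + x^(2-t) + ⋯ + x^t)^n, it is N_n(e - d) - N_n(e + d + 2).
-- The equality of the two differences is the case e = 0, d = 0 of n + 1 rows
-- against e = t, d = 0 of n rows; there the sum over a telescopes.
module Submission where

open import Defs
open import Data.Bool.Base using (true; false; if_then_else_)
open import Data.Fin.Base as Fin using (Fin)
open import Data.Fin.Patterns using (0F; 1F)
import Data.Fin.Properties as Fin
open import Data.Integer.Base as ℤ using (ℤ; +_; +[1+_]; -[1+_]; 0ℤ; _-_)
import Data.Integer.Properties as ℤ
import Data.Integer.Tactic.RingSolver as ℤ
open import Data.List.Base
  using (List; []; _∷_; _++_; _∷ʳ_; map; length; filter; reverse; drop; zip;
         inits; allFin; replicate; applyUpTo; applyDownFrom; cartesianProductWith)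
open import Data.List.Properties
  using (map-upTo; map-++; map-∘; ++-assoc; ++-identityʳ; length-++; length-reverse; drop-all;
         filter-++; filter-accept; filter-reject; filter-none; unfold-reverse; reverse-++)
open import Data.List.Relation.Binary.Pointwise.Base using (Pointwise; []; _∷_)
open import Data.List.Relation.Binary.Prefix.Heterogeneous using (Prefix; []; _∷_)
open import Data.List.Relation.Binary.Prefix.Heterogeneous.Properties using (prefix?)
open import Data.List.Relation.Unary.All as All using (All; []; _∷_)
import Data.List.Relation.Unary.All.Properties as All
open import Data.List.Relation.Unary.Linked as Linked using (Linked; []; [-]; _∷_)
open import Data.Nat.Base
open import Data.Nat.ListAction using (sum)
open import Data.Nat.ListAction.Properties using (sum-++)
open import Data.Nat.Properties
import Data.Nat.Tactic.RingSolver as ℕ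
open import Data.Product.Base using (_×_; _,_; ∃; proj₁; proj₂)
open import Data.Sum.Base using (inj₁; inj₂)
open import Function.Base using (_∘_)
open import Level using (0ℓ)
open import Relation.Binary.PropositionalEquality
open import Relation.Nullary using (¬_; contradiction)
open import Relation.Nullary.Decidable
  using (Dec; does; yes; no; map′; _×-dec_; dec-true; dec-false; isYes≗does)
open import Relation.Unary using (Pred; Decidable)

private variable
  A B C : Set

-- Finite sums of integers

Σ< : ℕ → (ℕ → ℤ) → ℤ
Σ< zero    f = 0ℤ
Σ< (suc n) f = f 0 ℤ.+ Σ< n (f ∘ suc)

Σ<-cong : ∀ n {f g : ℕ → ℤ} → (∀ i → i < n → f i ≡ g i) → Σ< n f ≡ Σ< n g
Σ<-cong zero    _   = refl
Σ<-cong (suc n) f≡g = cong₂ ℤ._+_ (f≡g 0 z<s) (Σ<-cong n (λ i i<n → f≡g (suc i) (s<s i<n)))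

Σ<-zero : ∀ n {f : ℕ → ℤ} → (∀ i → i < n → f i ≡ 0ℤ) → Σ< n f ≡ 0ℤ
Σ<-zero zero    _   = refl
Σ<-zero (suc n) f≡0 = cong₂ ℤ._+_ (f≡0 0 z<s) (Σ<-zero n (λ i i<n → f≡0 (suc i) (s<s i<n)))

Σ<-+ : ∀ m n (f : ℕ → ℤ) → Σ< (m + n) f ≡ Σ< m f ℤ.+ Σ< n (λ i → f (m + i))
Σ<-+ zero    n f = sym (ℤ.+-identityˡ _)
Σ<-+ (suc m) n f = trans (cong (ℤ._+_ (f 0)) (Σ<-+ m n (f ∘ suc))) (sym (ℤ.+-assoc (f 0) _ _))

Σ<-snoc : ∀ n (f : ℕ → ℤ) → Σ< (suc n) f ≡ Σ< n f ℤ.+ f n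
Σ<-snoc zero    f = ℤ.+-comm (f 0) 0ℤ
Σ<-snoc (suc n) f = trans (cong (ℤ._+_ (f 0)) (Σ<-snoc n (f ∘ suc))) (sym (ℤ.+-assoc (f 0) _ _))

Σ<-reverse : ∀ n (f : ℕ → ℤ) → Σ< (suc n) (λ i → f (n ∸ i)) ≡ Σ< (suc n) f
Σ<-reverse zero    f = refl
Σ<-reverse (suc n) f = begin
  f (suc n) ℤ.+ Σ< (suc n) (λ i → f (n ∸ i)) ≡⟨ cong (ℤ._+_ (f (suc n))) (Σ<-reverse n f) ⟩
  f (suc n) ℤ.+ Σ< (suc n) f                 ≡⟨ ℤ.+-comm (f (suc n)) _ ⟩
  Σ< (suc n) f ℤ.+ f (suc n)                 ≡⟨ Σ<-snoc (suc n) f ⟨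
  Σ< (suc (suc n)) f                         ∎
  where open ≡-Reasoning

Σ<-neg : ∀ n (f : ℕ → ℤ) → Σ< n (λ i → ℤ.- f i) ≡ ℤ.- Σ< n f
Σ<-neg zero    f = refl
Σ<-neg (suc n) f = trans (cong (ℤ._+_ (ℤ.- f 0)) (Σ<-neg n (f ∘ suc))) (sym (ℤ.neg-distrib-+ (f 0) _))

Σ<-minus : ∀ n (f g : ℕ → ℤ) → Σ< n (λ i → f i - g i) ≡ Σ< n f - Σ< n g
Σ<-minus zero    f g = refl
Σ<-minus (suc n) f g =
  trans (cong (ℤ._+_ (f 0 - g 0)) (Σ<-minus n (f ∘ suc) (g ∘ suc))) (interchange (f 0) (g 0) _ _)
  where
  interchange : ∀ a b c d → a - b ℤ.+ (c - d) ≡ a ℤ.+ c - (b ℤ.+ d)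
  interchange = ℤ.solve-∀

Σ<-sum : ∀ n (f : ℕ → ℕ) → + sum (applyUpTo f n) ≡ Σ< n (+_ ∘ f)
Σ<-sum zero    f = refl
Σ<-sum (suc n) f = cong (ℤ._+_ (+ f 0)) (Σ<-sum n (f ∘ suc))

pos-∸ : ∀ {m n} → n ≤ m → + (m ∸ n) ≡ + m - + n
pos-∸ {m} {n} n≤m = sym (trans (ℤ.m-n≡m⊖n m n) (ℤ.⊖-≥ n≤m))

-- The substitution of t - a for a: both sums run over w - t, w - t + 2, ..., w + t, in opposite
-- orders.
Σ<-flip : ∀ t (F : ℤ → ℤ) w →
  Σ< (suc t) (λ a → F (w ℤ.+ + t - (+ a ℤ.+ + a))) ≡ Σ< (suc t) (λ a → F (w - + t ℤ.+ (+ a ℤ.+ + a)))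
Σ<-flip t F w = trans
  (sym (Σ<-reverse t (λ a → F (w ℤ.+ + t - (+ a ℤ.+ + a)))))
  (Σ<-cong (suc t) λ a a≤t → cong F (trans
    (cong (λ z → w ℤ.+ + t - (z ℤ.+ z)) (pos-∸ (s≤s⁻¹ a≤t)))
    (rearrange w (+ t) (+ a))))
  where
  rearrange : ∀ w t a → w ℤ.+ t - (t - a ℤ.+ (t - a)) ≡ w - t ℤ.+ (a ℤ.+ a)
  rearrange = ℤ.solve-∀

≡-neg⇒≡0 : ∀ {i} → i ≡ ℤ.- i → i ≡ 0ℤ
≡-neg⇒≡0 {+ zero}  _  = refl
≡-neg⇒≡0 {+[1+ n ]} ()
≡-neg⇒≡0 { -[1+ n ]} ()

-- Centred t-binomial coefficients

-- The coefficient of x^w in (x^(-t) + x^(2-t) + ⋯ + x^t)^n.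
coeff : ℕ → ℕ → ℤ → ℤ
coeff t zero    (+ zero) = + 1
coeff t zero    _        = 0ℤ
coeff t (suc n) w        = Σ< (suc t) λ a → coeff t n (w ℤ.+ + t - (+ a ℤ.+ + a))

-- Each factor is invariant under exchanging x and 1/x; in the recursion this reverses the order of
-- the sum.
coeff-neg : ∀ t n w → coeff t n (ℤ.- w) ≡ coeff t n w
coeff-neg t zero (+ zero)  = refl
coeff-neg t zero +[1+ _ ]  = refl
coeff-neg t zero -[1+ _ ]  = refl
coeff-neg t (suc n) w = trans
  (Σ<-cong (suc t) λ a _ → trans
    (cong (coeff t n) (rearrange w (+ t) (+ a)))
    (coeff-neg t n _))
  (sym (Σ<-flip t (coeff t n) w))
  where
  rearrange : ∀ w t a → ℤ.- w ℤ.+ t - (a ℤ.+ a) ≡ ℤ.- (w - t ℤ.+ (a ℤ.+ a))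
  rearrange = ℤ.solve-∀

-- The lowest exponent is -tn. Removing a factor keeps the exponent in the form -(k + 1) - tn, with
-- k replaced by k + 2a.
coeff-below : ∀ t n k → coeff t n (-[1+ k ] ℤ.- + (t * n)) ≡ 0ℤ
coeff-below t zero k rewrite *-zeroʳ t = refl
coeff-below t (suc n) k = Σ<-zero (suc t) λ a _ →
  trans (cong (coeff t n) (rearranged a)) (coeff-below t n (k + (a + a)))
  where
  rearrange : ∀ k t n a → ℤ.- (+ 1 ℤ.+ k) - (t ℤ.+ n) ℤ.+ t - (a ℤ.+ a) ≡ ℤ.- (+ 1 ℤ.+ (k ℤ.+ (a ℤ.+ a))) - n
  rearrange = ℤ.solve-∀
  rearranged : ∀ a → -[1+ k ] ℤ.- + (t * suc n) ℤ.+ + t - (+ a ℤ.+ + a) ≡ -[1+ k + (a + a) ] ℤ.- + (t * n)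
  rearranged a rewrite *-suc t n = rearrange (+ k) (+ t) (+ (t * n)) (+ a)

-- Replacing x by x^2 and multiplying by x^(-tn) centres the polynomial, so the exponent k becomes
-- 2k - tn.
tBinomial-coeff : ∀ t n k → + tBinomial t n k ≡ coeff t n (+ (k + k) - + (t * n))
tBinomial-coeff t zero    zero    rewrite *-zeroʳ t = refl
tBinomial-coeff t zero    (suc k) rewrite *-zeroʳ t = refl
tBinomial-coeff t (suc n) k = begin
  + tBinomial t (suc n) k
    ≡⟨ cong +_ (cong sum (map-upTo term (suc k))) ⟩
  + sum (applyUpTo term (suc k))
    ≡⟨ Σ<-sum (suc k) term ⟩
  Σ< (suc k) (+_ ∘ term)
    ≡⟨ Σ<-cong (suc k) (λ i i≤k → term≡ i (s≤s⁻¹ i≤k)) ⟩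
  Σ< (suc k) shifted
    -- The convolution stops at i = k, the recursion of `coeff` at a = t. Both are extended to a
    -- common range: past k the exponent drops below -tn, past t the geometric coefficient is 0.
    ≡⟨ extend k t shifted (λ i → beyond-k i) ⟨
  Σ< (suc k + suc t) shifted
    ≡⟨ cong (λ l → Σ< l shifted) (+-comm (suc k) (suc t)) ⟩
  Σ< (suc t + suc k) shifted
    ≡⟨ extend t k shifted beyond-t ⟩
  Σ< (suc t) shifted
    ≡⟨ Σ<-cong (suc t) (λ i i≤t → trans (inside i (s≤s⁻¹ i≤t)) (cong (coeff t n) (aligned i))) ⟩
  coeff t (suc n) (+ (k + k) - + (t * suc n)) ∎
  where
  open ≡-Reasoning
  term : ℕ → ℕ
  term i = geometric t i * tBinomial t n (k ∸ i)
  at : ℕ → ℤ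
  at i = coeff t n (+ (k + k) - (+ i ℤ.+ + i) - + (t * n))
  shifted : ℕ → ℤ
  shifted i = + geometric t i ℤ.* at i
  rearrange₁ : ∀ k i m → k - i ℤ.+ (k - i) - m ≡ k ℤ.+ k - (i ℤ.+ i) - m
  rearrange₁ = ℤ.solve-∀
  term≡ : ∀ i → i ≤ k → + term i ≡ shifted i
  term≡ i i≤k = trans (ℤ.pos-* (geometric t i) _) (cong (ℤ._*_ (+ geometric t i))
    (trans (tBinomial-coeff t n (k ∸ i)) (cong (coeff t n) (trans
      (cong (λ z → z ℤ.+ z - + (t * n)) (pos-∸ i≤k))
      (rearrange₁ (+ k) (+ i) (+ (t * n)))))))
  extend : ∀ m l f → (∀ i → f (suc m + i) ≡ 0ℤ) → Σ< (suc m + suc l) f ≡ Σ< (suc m) f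
  extend m l f vanish = trans (Σ<-+ (suc m) (suc l) f)
    (trans (cong (ℤ._+_ (Σ< (suc m) f)) (Σ<-zero (suc l) (λ i _ → vanish i))) (ℤ.+-identityʳ _))
  rearrange₂ : ∀ k i m → k ℤ.+ k - (+ 1 ℤ.+ k ℤ.+ i ℤ.+ (+ 1 ℤ.+ k ℤ.+ i)) - m ≡ ℤ.- (+ 1 ℤ.+ (+ 1 ℤ.+ (i ℤ.+ i))) - m
  rearrange₂ = ℤ.solve-∀
  beyond-k : ∀ i → shifted (suc k + i) ≡ 0ℤ
  beyond-k i = trans (cong (ℤ._*_ (+ geometric t (suc k + i)))
    (trans (cong (coeff t n) (rearrange₂ (+ k) (+ i) (+ (t * n)))) (coeff-below t n (suc (i + i)))))
    (ℤ.*-zeroʳ (+ geometric t (suc k + i)))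
  beyond-t : ∀ i → shifted (suc t + i) ≡ 0ℤ
  -- `does (i ≤? t)` reduces to the test `i ≤ᵇ t` in `geometric`.
  beyond-t i rewrite dec-false (suc t + i ≤? t) (m+n≮m t i) = refl
  inside : ∀ i → i ≤ t → shifted i ≡ at i
  inside i i≤t rewrite dec-true (i ≤? t) i≤t = ℤ.*-identityˡ _
  rearrange₃ : ∀ k i t m → k - (i ℤ.+ i) - m ≡ k - (t ℤ.+ m) ℤ.+ t - (i ℤ.+ i)
  rearrange₃ = ℤ.solve-∀
  aligned : ∀ i → + (k + k) - (+ i ℤ.+ + i) - + (t * n) ≡ + (k + k) - + (t * suc n) ℤ.+ + t - (+ i ℤ.+ + i)
  aligned i rewrite *-suc t n = rearrange₃ (+ (k + k)) (+ i) (+ t) (+ (t * n))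

-- Tensor multiplicities and the reflection principle

-- For d ≥ 0, the multiplicity of V_e in V_d ⊗ V_t^(⊗ n), where V_d is the
-- (d+1)-dimensional irreducible representation of SL(2).
mult : ℕ → ℕ → ℕ → ℤ → ℤ
mult t e n d = coeff t n (+ e - d) - coeff t n (+ e ℤ.+ d ℤ.+ + 2)

-- Reflection of d in -1 exchanges the two coefficients of the difference.
mult-antisym : ∀ t e n d → mult t e n (ℤ.- (d ℤ.+ + 2)) ≡ ℤ.- mult t e n d
mult-antisym t e n d = trans
  (cong₂ (λ x y → coeff t n x - coeff t n y) (rearrange₁ (+ e) d) (rearrange₂ (+ e) d))
  (swap (coeff t n (+ e ℤ.+ d ℤ.+ + 2)) _)
  where
  rearrange₁ : ∀ e d → e - ℤ.- (d ℤ.+ + 2) ≡ e ℤ.+ d ℤ.+ + 2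
  rearrange₁ = ℤ.solve-∀
  rearrange₂ : ∀ e d → e ℤ.+ ℤ.- (d ℤ.+ + 2) ℤ.+ + 2 ≡ e - d
  rearrange₂ = ℤ.solve-∀
  swap : ∀ x y → x - y ≡ ℤ.- (y - x)
  swap = ℤ.solve-∀

-- Since d enters the two coefficients with opposite signs, one of the two sums is reversed to make
-- the shifts of d agree. Negative values of d are included here.
mult-suc : ∀ t e n d → mult t e (suc n) d ≡ Σ< (suc t) λ a → mult t e n (d - + t ℤ.+ (+ a ℤ.+ + a))
mult-suc t e n d = begin
  coeff t (suc n) (+ e - d) - coeff t (suc n) (+ e ℤ.+ d ℤ.+ + 2)
    ≡⟨ cong (_-_ (coeff t (suc n) (+ e - d))) (Σ<-flip t (coeff t n) (+ e ℤ.+ d ℤ.+ + 2)) ⟩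
  Σ< (suc t) (λ a → coeff t n (+ e - d ℤ.+ + t - (+ a ℤ.+ + a)))
    - Σ< (suc t) (λ a → coeff t n (+ e ℤ.+ d ℤ.+ + 2 - + t ℤ.+ (+ a ℤ.+ + a)))
    ≡⟨ Σ<-minus (suc t)
         (λ a → coeff t n (+ e - d ℤ.+ + t - (+ a ℤ.+ + a)))
         (λ a → coeff t n (+ e ℤ.+ d ℤ.+ + 2 - + t ℤ.+ (+ a ℤ.+ + a))) ⟨
  Σ< (suc t) (λ a → coeff t n (+ e - d ℤ.+ + t - (+ a ℤ.+ + a))
    - coeff t n (+ e ℤ.+ d ℤ.+ + 2 - + t ℤ.+ (+ a ℤ.+ + a)))
    ≡⟨ Σ<-cong (suc t) (λ a _ → cong₂ (λ x y → coeff t n x - coeff t n y)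
         (rearrange₁ (+ e) d (+ t) (+ a ℤ.+ + a)) (rearrange₂ (+ e) d (+ t) (+ a ℤ.+ + a))) ⟩
  Σ< (suc t) (λ a → mult t e n (d - + t ℤ.+ (+ a ℤ.+ + a))) ∎
  where
  open ≡-Reasoning
  rearrange₁ : ∀ e d t a → e - d ℤ.+ t - a ≡ e - (d - t ℤ.+ a)
  rearrange₁ = ℤ.solve-∀
  rearrange₂ : ∀ e d t a → e ℤ.+ d ℤ.+ + 2 - t ℤ.+ a ≡ e ℤ.+ (d - t ℤ.+ a) ℤ.+ + 2
  rearrange₂ = ℤ.solve-∀

-- The terms a and s − a cancel.
mult-cancel : ∀ t e n s → Σ< (suc s) (λ a → mult t e n (+ a ℤ.+ + a - + suc s)) ≡ 0ℤ
mult-cancel t e n s = ≡-neg⇒≡0 (begin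
  Σ< (suc s) f                  ≡⟨ Σ<-reverse s f ⟨
  Σ< (suc s) (λ a → f (s ∸ a))  ≡⟨ Σ<-cong (suc s) (λ a a≤s → opposite a (s≤s⁻¹ a≤s)) ⟩
  Σ< (suc s) (λ a → ℤ.- f a)    ≡⟨ Σ<-neg (suc s) f ⟩
  ℤ.- Σ< (suc s) f              ∎)
  where
  open ≡-Reasoning
  f : ℕ → ℤ
  f a = mult t e n (+ a ℤ.+ + a - + suc s)
  rearrange : ∀ s a → s - a ℤ.+ (s - a) - (+ 1 ℤ.+ s) ≡ ℤ.- (a ℤ.+ a - (+ 1 ℤ.+ s) ℤ.+ + 2)
  rearrange = ℤ.solve-∀
  opposite : ∀ a → a ≤ s → f (s ∸ a) ≡ ℤ.- f a
  opposite a a≤s = trans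
    (cong (mult t e n) (trans (cong (λ z → z ℤ.+ z - + suc s) (pos-∸ a≤s)) (rearrange (+ s) (+ a))))
    (mult-antisym t e n (+ a ℤ.+ + a - + suc s))

-- Clebsch–Gordan: the terms with t ∸ a > d, absent from V_d ⊗ V_t, cancel.
mult-rec : ∀ t e n d (g : ℕ → ℤ) →
  (∀ a → a ≤ t → t ∸ a ≤ d → g a ≡ mult t e n (+ (a + (d ∸ (t ∸ a))))) →
  (∀ a → a ≤ t → d < t ∸ a → g a ≡ 0ℤ) →
  Σ< (suc t) g ≡ mult t e (suc n) (+ d)
mult-rec t e n d g inside outside = trans sum≡ (sym (mult-suc t e n (+ d)))
  where
  open ≡-Reasoning
  f : ℕ → ℤ
  f a = mult t e n (+ d - + t ℤ.+ (+ a ℤ.+ + a))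
  rearrange₁ : ∀ a d t → a ℤ.+ (d - (t - a)) ≡ d - t ℤ.+ (a ℤ.+ a)
  rearrange₁ = ℤ.solve-∀
  inside′ : ∀ a → a ≤ t → t ∸ a ≤ d → g a ≡ f a
  inside′ a a≤t t-a≤d = trans (inside a a≤t t-a≤d) (cong (mult t e n) (trans
    (cong (ℤ._+_ (+ a)) (trans (pos-∸ t-a≤d) (cong (_-_ (+ d)) (pos-∸ a≤t))))
    (rearrange₁ (+ a) (+ d) (+ t))))
  rearrange₂ : ∀ a s d → a ℤ.+ a - (+ 1 ℤ.+ s) ≡ d - (+ 1 ℤ.+ s ℤ.+ d) ℤ.+ (a ℤ.+ a)
  rearrange₂ = ℤ.solve-∀
  -- When d < t, put s = t - d - 1. The forbidden indices are a = 0, ..., s, and their states d - t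
  -- + 2a = 2a - (s + 1) lie symmetrically about -1.
  split : ∃ (λ s → t ≡ suc s + d) → Σ< (suc t) g ≡ Σ< (suc t) f
  split (s , t≡) = begin
    Σ< (suc t) g
      ≡⟨ cong (λ l → Σ< l g) t≡′ ⟩
    Σ< (suc s + suc d) g
      ≡⟨ Σ<-+ (suc s) (suc d) g ⟩
    Σ< (suc s) g ℤ.+ Σ< (suc d) (λ i → g (suc s + i))
      ≡⟨ cong₂ ℤ._+_ (trans (Σ<-zero (suc s) g-low) (sym f-low)) (Σ<-cong (suc d) high) ⟩
    Σ< (suc s) f ℤ.+ Σ< (suc d) (λ i → f (suc s + i))
      ≡⟨ Σ<-+ (suc s) (suc d) f ⟨
    Σ< (suc s + suc d) f
      ≡⟨ cong (λ l → Σ< l f) t≡′ ⟨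
    Σ< (suc t) f ∎
    where
    t≡′ : suc t ≡ suc s + suc d
    t≡′ = trans (cong suc t≡) (sym (+-suc (suc s) d))
    g-low : ∀ a → a < suc s → g a ≡ 0ℤ
    g-low a (s≤s a≤s) = outside a
      (≤-trans a≤s (≤-trans (m≤n⇒m≤1+n (m≤m+n s d)) (≤-reflexive (sym t≡))))
      (subst (λ l → d < l) (sym (trans (cong (_∸ a) t≡) (+-∸-comm d (m≤n⇒m≤1+n a≤s))))
        (m<n+m d (m<n⇒0<n∸m (s≤s a≤s))))
    f-low : Σ< (suc s) f ≡ 0ℤ
    f-low = trans
      (Σ<-cong (suc s) λ a _ → cong (mult t e n) (sym (trans (rearrange₂ (+ a) (+ s) (+ d))
        (cong (λ z → + d - + z ℤ.+ (+ a ℤ.+ + a)) (sym t≡)))))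
      (mult-cancel t e n s)
    high : ∀ i → i < suc d → g (suc s + i) ≡ f (suc s + i)
    high i (s≤s i≤d) = inside′ (suc s + i)
      (≤-trans (+-monoʳ-≤ (suc s) i≤d) (≤-reflexive (sym t≡)))
      (≤-trans (≤-reflexive (trans (cong (_∸ (suc s + i)) t≡) ([m+n]∸[m+o]≡n∸o (suc s) d i))) (m∸n≤m d i))
  sum≡ : Σ< (suc t) g ≡ Σ< (suc t) f
  sum≡ with ≤-<-connex t d
  ... | inj₁ t≤d = Σ<-cong (suc t) λ a a≤t → inside′ a (s≤s⁻¹ a≤t) (≤-trans (m∸n≤m t a) t≤d)
  ... | inj₂ d<t = split (t ∸ suc d , trans (sym (m∸n+n≡m d<t)) (+-suc (t ∸ suc d) d))

-- Ballot words as walks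

-- Ballot words read as walks: the state d is the number of 1s minus the number
-- of 2s so far, kept nonnegative, and the walk ends in state e.
data Walk (e : ℕ) : ℕ → List (Fin 2) → Set where
  stop : Walk e e []
  up   : ∀ {d w} → Walk e (suc d) w → Walk e d (0F ∷ w)
  down : ∀ {d w} → Walk e d w → Walk e (suc d) (1F ∷ w)

walk? : ∀ e d w → Dec (Walk e d w)
walk? e d []             = map′ (λ { refl → stop }) (λ { stop → refl }) (e ≟ d)
walk? e d (0F ∷ w)       = map′ up (λ { (up p) → p }) (walk? e (suc d) w)
walk? e zero (1F ∷ w)    = no λ ()
walk? e (suc d) (1F ∷ w) = map′ down (λ { (down p) → p }) (walk? e d w)

walk-ups : ∀ {e d v} a → Walk e (a + d) v → Walk e d (replicate a 0F ++ v)
walk-ups zero p = p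
walk-ups {e} {d} {v} (suc a) p = up (walk-ups a (subst (λ l → Walk e l v) (sym (+-suc a d)) p))

walk-ups⁻ : ∀ {e d v} a → Walk e d (replicate a 0F ++ v) → Walk e (a + d) v
walk-ups⁻ zero p = p
walk-ups⁻ {e} {d} {v} (suc a) (up p) = subst (λ l → Walk e l v) (+-suc a d) (walk-ups⁻ a p)

walk-downs : ∀ {e d v} b → b ≤ d → Walk e (d ∸ b) v → Walk e d (replicate b 1F ++ v)
walk-downs zero    _         p = p
walk-downs (suc b) (s≤s b≤d) p = down (walk-downs b b≤d p)

walk-downs⁻ : ∀ {e d v} b → Walk e d (replicate b 1F ++ v) → b ≤ d × Walk e (d ∸ b) v
walk-downs⁻ zero    p        = z≤n , p
walk-downs⁻ (suc b) (down p) = let b≤d , q = walk-downs⁻ b p in s≤s b≤d , q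

-- A surplus of d 1s is allowed at the start, so that the condition passes to the tail of a word.
BallotFrom : ℕ → List (Fin 2) → Set
BallotFrom d w = All (λ u → count 1F u ≤ d + count 0F u) (inits w)

walk⇒balance : ∀ {e d w} → Walk e d w → d + count 0F w ≡ e + count 1F w
walk⇒balance stop = refl
walk⇒balance (up p) = trans (+-suc _ _) (walk⇒balance p)
walk⇒balance {e} (down p) = trans (cong suc (walk⇒balance p)) (sym (+-suc e _))

walk⇒ballot : ∀ {e d w} → Walk e d w → BallotFrom d w
walk⇒ballot stop = z≤n ∷ []
walk⇒ballot {d = d} (up p) = z≤n ∷ All.map⁺ (All.map (λ {u} → subst (count 1F u ≤_) (sym (+-suc d _))) (walk⇒ballot p))
walk⇒ballot (down p) = z≤n ∷ All.map⁺ (All.map s≤s (walk⇒ballot p))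

-- The ballot condition keeps the state nonnegative; the balance equation fixes the final state.
ballot⇒walk : ∀ {e d} w → BallotFrom d w → d + count 0F w ≡ e + count 1F w → Walk e d w
ballot⇒walk {e} {d} [] _ eq = subst (λ l → Walk e l []) (trans (sym (+-identityʳ e)) (trans (sym eq) (+-identityʳ d))) stop
ballot⇒walk {e} {d} (0F ∷ w) (_ ∷ ps) eq = up (ballot⇒walk w
  (All.map (λ {u} → subst (count 1F u ≤_) (+-suc d _)) (All.map⁻ ps))
  (trans (sym (+-suc d _)) eq))
ballot⇒walk {e} {suc d} (1F ∷ w) (_ ∷ ps) eq = down (ballot⇒walk w
  (All.map s≤s⁻¹ (All.map⁻ ps))
  (suc-injective (trans eq (+-suc e _))))
-- The prefix formed by the single letter 2 already violates the condition.
ballot⇒walk {e} {zero} (1F ∷ w) (_ ∷ () ∷ _) eq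

count-length : (w : List (Fin 2)) → count 0F w + count 1F w ≡ length w
count-length []       = refl
count-length (0F ∷ w) = cong suc (count-length w)
count-length (1F ∷ w) = trans (+-suc _ _) (cong suc (count-length w))

-- For the strips below this is the Littlewood-Richardson condition, with the content expressed by
-- the final state e. Letting d vary allows rows to be removed from the top.
Good : ℕ → ℕ → Pred (Filling 2) 0ℓ
Good e d T = RowWeak T × Walk e d (readingWord T)

good? : ∀ e d → Decidable (Good e d)
good? e d T = All.all? (λ (_ , w) → Linked.linked? Fin._≤?_ w) T ×-dec walk? e d (readingWord T)

-- Counting with filters and sums over sorted words

length-filter-cong : {P Q : Pred A 0ℓ} (P? : Decidable P) (Q? : Decidable Q) {xs : List A} →
  All (λ x → (P x → Q x) × (Q x → P x)) xs → length (filter P? xs) ≡ length (filter Q? xs)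
length-filter-cong P? Q? []                    = refl
length-filter-cong P? Q? {x ∷ xs} (P⇔Q ∷ rest) with P? x | Q? x
... | yes _ | yes _ = cong suc (length-filter-cong P? Q? rest)
... | no _  | no _  = length-filter-cong P? Q? rest
... | yes p | no ¬q = contradiction (proj₁ P⇔Q p) ¬q
... | no ¬p | yes q = contradiction (proj₂ P⇔Q q) ¬p

length-filter-map : {P : Pred B 0ℓ} (P? : Decidable P) (f : A → B) (xs : List A) →
  length (filter P? (map f xs)) ≡ length (filter (P? ∘ f) xs)
length-filter-map P? f []       = refl
length-filter-map P? f (x ∷ xs) with does (P? (f x))
... | true  = cong suc (length-filter-map P? f xs)
... | false = length-filter-map P? f xs

length-filter-product : {P : Pred C 0ℓ} (P? : Decidable P) (f : A → B → C) (xs : List A) (ys : List B) →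
  length (filter P? (cartesianProductWith f xs ys)) ≡ sum (map (λ x → length (filter (P? ∘ f x) ys)) xs)
length-filter-product P? f []       ys = refl
length-filter-product P? f (x ∷ xs) ys = begin
  length (filter P? (map (f x) ys ++ cartesianProductWith f xs ys))
    ≡⟨ cong length (filter-++ P? (map (f x) ys) _) ⟩
  length (filter P? (map (f x) ys) ++ filter P? (cartesianProductWith f xs ys))
    ≡⟨ length-++ (filter P? (map (f x) ys)) ⟩
  length (filter P? (map (f x) ys)) + length (filter P? (cartesianProductWith f xs ys))
    ≡⟨ cong₂ _+_ (length-filter-map P? (f x) ys) (length-filter-product P? f xs ys) ⟩
  length (filter (P? ∘ f x) ys) + sum (map (λ x → length (filter (P? ∘ f x) ys)) xs) ∎
  where open ≡-Reasoning

Sorted : List (Fin 2) → Set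
Sorted = Linked Fin._≤_

sortedWord : ℕ → ℕ → List (Fin 2)
sortedWord a b = replicate a 0F ++ replicate b 1F

sortedWord-sorted : ∀ a b → Sorted (sortedWord a b)
sortedWord-sorted zero          zero          = []
sortedWord-sorted zero          (suc zero)    = [-]
sortedWord-sorted zero          (suc (suc b)) = ≤-refl ∷ sortedWord-sorted zero (suc b)
sortedWord-sorted (suc zero)    zero          = [-]
sortedWord-sorted (suc zero)    (suc b)       = z≤n ∷ sortedWord-sorted zero (suc b)
sortedWord-sorted (suc (suc a)) b             = z≤n ∷ sortedWord-sorted (suc a) b

sum-words-suc : ∀ n (g : List (Fin 2) → ℕ) →
  sum (map g (words 2 (suc n))) ≡ sum (map (g ∘ (0F ∷_)) (words 2 n)) + sum (map (g ∘ (1F ∷_)) (words 2 n))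
sum-words-suc n g = begin
  sum (map g (map (0F ∷_) ws ++ map (1F ∷_) ws ++ []))
    ≡⟨ cong (λ vs → sum (map g (map (0F ∷_) ws ++ vs))) (++-identityʳ _) ⟩
  sum (map g (map (0F ∷_) ws ++ map (1F ∷_) ws))
    ≡⟨ cong sum (map-++ g (map (0F ∷_) ws) _) ⟩
  sum (map g (map (0F ∷_) ws) ++ map g (map (1F ∷_) ws))
    ≡⟨ sum-++ (map g (map (0F ∷_) ws)) _ ⟩
  sum (map g (map (0F ∷_) ws)) + sum (map g (map (1F ∷_) ws))
    ≡⟨ cong₂ (λ x y → sum x + sum y) (map-∘ ws) (map-∘ ws) ⟨
  sum (map (g ∘ (0F ∷_)) ws) + sum (map (g ∘ (1F ∷_)) ws) ∎
  where
  open ≡-Reasoning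
  ws = words 2 n

sum-zero : (g : A → ℕ) (xs : List A) → (∀ x → g x ≡ 0) → sum (map g xs) ≡ 0
sum-zero g []       g≡0 = refl
sum-zero g (x ∷ xs) g≡0 = cong₂ _+_ (g≡0 x) (sum-zero g xs g≡0)

SupportedOnSorted : (List (Fin 2) → ℕ) → Set
SupportedOnSorted g = ∀ w → ¬ Sorted w → g w ≡ 0

supported-∷ : ∀ {g} i → SupportedOnSorted g → SupportedOnSorted (g ∘ (i ∷_))
supported-∷ i supp w ¬sorted = supp (i ∷ w) (¬sorted ∘ Linked.tail)

-- After a 2, a sorted word has only 2s.
sum-words-1∷ : ∀ n {g} → SupportedOnSorted g →
  sum (map (g ∘ (1F ∷_)) (words 2 n)) ≡ g (replicate (suc n) 1F)
sum-words-1∷ zero    {g} supp = +-identityʳ _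
sum-words-1∷ (suc n) {g} supp = trans (sum-words-suc n (g ∘ (1F ∷_))) (cong₂ _+_
  (sum-zero _ (words 2 n) λ w → supp (1F ∷ 0F ∷ w) λ { (() ∷ _) })
  (sum-words-1∷ n (supported-∷ 1F supp)))

-- A sorted word in two letters is determined by its number a of 1s.
sum-words : ∀ n {g} → SupportedOnSorted g →
  + sum (map g (words 2 n)) ≡ Σ< (suc n) (λ a → + g (sortedWord a (n ∸ a)))
sum-words zero    {g} supp = refl
sum-words (suc n) {g} supp = begin
  + sum (map g (words 2 (suc n)))
    -- The words starting with 2 are moved to the front, since they supply the term a = 0.
    ≡⟨ cong +_ (trans (sum-words-suc n g) (+-comm (sum (map (g ∘ (0F ∷_)) (words 2 n))) _)) ⟩
  + sum (map (g ∘ (1F ∷_)) (words 2 n)) ℤ.+ + sum (map (g ∘ (0F ∷_)) (words 2 n))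
    ≡⟨ cong₂ ℤ._+_ (cong +_ (sum-words-1∷ n supp)) (sum-words n (supported-∷ 0F supp)) ⟩
  Σ< (suc (suc n)) (λ a → + g (sortedWord a (suc n ∸ a))) ∎
  where open ≡-Reasoning

-- Counting good fillings row by row

reverse-replicate : ∀ n (x : A) → reverse (replicate n x) ≡ replicate n x
reverse-replicate zero    x = refl
reverse-replicate (suc n) x = trans (unfold-reverse x (replicate n x))
  (trans (cong (_∷ʳ x) (reverse-replicate n x)) (replicate-∷ʳ n))
  where
  replicate-∷ʳ : ∀ n → replicate n x ∷ʳ x ≡ x ∷ replicate n x
  replicate-∷ʳ zero    = refl
  replicate-∷ʳ (suc n) = cong (x ∷_) (replicate-∷ʳ n)

reverse-sortedWord : ∀ a b → reverse (sortedWord a b) ≡ replicate b 1F ++ replicate a 0F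
reverse-sortedWord a b = trans (reverse-++ (replicate a 0F) _)
  (cong₂ _++_ (reverse-replicate b 1F) (reverse-replicate a 0F))

readingWord-∷ : ∀ o a b (T : Filling 2) →
  readingWord ((o , sortedWord a b) ∷ T) ≡ replicate b 1F ++ replicate a 0F ++ readingWord T
readingWord-∷ o a b T = trans (cong (_++ readingWord T) (reverse-sortedWord a b)) (++-assoc (replicate b 1F) _ _)

-- A row is read from right to left, 2s first, so the state is lowest after its b down steps;
-- `b ≤ d` is the ballot condition for the row.
good-∷ : ∀ {e d T} o a b → b ≤ d → Good e (a + (d ∸ b)) T → Good e d ((o , sortedWord a b) ∷ T)
good-∷ {e} {d} {T} o a b b≤d (weak , walk) = sortedWord-sorted a b ∷ weak ,
  subst (Walk e d) (sym (readingWord-∷ o a b T)) (walk-downs b b≤d (walk-ups a walk))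

good-∷⁻ : ∀ {e d T} o a b → Good e d ((o , sortedWord a b) ∷ T) → b ≤ d × Good e (a + (d ∸ b)) T
good-∷⁻ {e} {d} {T} o a b (_ ∷ weak , walk) =
  let b≤d , walk′ = walk-downs⁻ b (subst (Walk e d) (readingWord-∷ o a b T) walk)
  in b≤d , weak , walk-ups⁻ a walk′

-- Each row starts in the column just after the last column of the row beneath it.
strip : ℕ → ℕ → List (ℕ × ℕ)
strip t = applyDownFrom (λ i → t * i , t)

-- Induction on the rows, for all d at once because the top row changes the state. Fillings are
-- grouped by their top row.
count-good : ∀ t e n d → + length (filter (good? e d) (fillings 2 (strip t n))) ≡ mult t e n (+ d)
count-good t e zero d with e ≟ d
-- With no rows, the first coefficient of `mult` tests e = d. The second, at e + d + 2, reduces to 0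
-- once `+-comm` exposes a successor.
... | yes refl = trans
  (cong (+_ ∘ length) (filter-accept (good? e d) {x = []} {xs = []} ([] , stop)))
  (sym (cong₂ (λ x y → coeff t 0 x - coeff t 0 y) (ℤ.+-inverseʳ (+ e)) (cong +_ (+-comm (e + e) 2))))
... | no e≢d = trans
  (cong (+_ ∘ length) (filter-reject (good? e d) {x = []} {xs = []} λ { (_ , stop) → e≢d refl }))
  (sym (cong₂ _-_
    (coeff-≢0 (e≢d ∘ ℤ.+-injective ∘ ℤ.i-j≡0⇒i≡j (+ e) (+ d)))
    (cong (λ x → coeff t 0 (+ x)) (+-comm (e + d) 2))))
  where
  coeff-≢0 : ∀ {w} → w ≢ 0ℤ → coeff t 0 w ≡ 0ℤ
  coeff-≢0 {+ zero}    w≢0 = contradiction refl w≢0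
  coeff-≢0 {ℤ.+[1+ _ ]} _  = refl
  coeff-≢0 {ℤ.-[1+ _ ]} _  = refl
count-good t e (suc n) d = begin
  + length (filter (good? e d) (fillings 2 (strip t (suc n))))
    ≡⟨ cong +_ (length-filter-product (good? e d) _ (words 2 t) Ts) ⟩
  + sum (map starting (words 2 t))
    ≡⟨ sum-words t (λ w ¬sorted → cong length (filter-none (good? e d ∘ row w) (All.universal (λ { T (sorted ∷ _ , _) → ¬sorted sorted }) Ts))) ⟩
  Σ< (suc t) (λ a → + starting (sortedWord a (t ∸ a)))
    -- If t - a ≤ d, the remaining rows form a good filling from the new state; otherwise the top
    -- row breaks the ballot condition.
    ≡⟨ mult-rec t e n d _
         (λ a _ b≤d → trans
           (cong +_ (length-filter-cong (good? e d ∘ row (sortedWord a (t ∸ a))) (good? e (a + (d ∸ (t ∸ a))))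
             (All.universal (λ T → proj₂ ∘ good-∷⁻ (t * n) a (t ∸ a) , good-∷ (t * n) a (t ∸ a) b≤d) Ts)))
           (count-good t e n (a + (d ∸ (t ∸ a)))))
         (λ a _ d<b → cong (+_ ∘ length) (filter-none (good? e d ∘ row (sortedWord a (t ∸ a)))
           (All.universal (λ T good → <⇒≱ d<b (proj₁ (good-∷⁻ (t * n) a (t ∸ a) good))) Ts))) ⟩
  mult t e (suc n) (+ d) ∎
  where
  open ≡-Reasoning
  Ts = fillings 2 (strip t n)
  row : List (Fin 2) → Filling 2 → Filling 2
  row w T = (t * n , w) ∷ T
  starting : List (Fin 2) → ℕ
  starting w = length (filter (good? e d ∘ row w) Ts)

-- Littlewood-Richardson fillings of a strip

-- The type `Filling` does not record a shape; this recovers it for the members of `fillings`.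
Fits : ∀ {r} → ℕ × ℕ → ℕ × List (Fin r) → Set
Fits (o , n) (o′ , w) = o ≡ o′ × length w ≡ n

words-length : ∀ r n → All (λ w → length w ≡ n) (words r n)
words-length r zero    = refl ∷ []
words-length r (suc n) = All.cartesianProductWith⁺ (setoid _) (setoid _) _∷_ (allFin r) (words r n)
  λ _ w∈ → cong suc (All.lookup (words-length r n) w∈)

fillings-fit : ∀ r rows → All (Pointwise Fits rows) (fillings r rows)
fillings-fit r []               = [] ∷ []
fillings-fit r ((o , n) ∷ rows) = All.cartesianProductWith⁺ (setoid _) (setoid _) _ (words r n) (fillings r rows)
  λ w∈ T∈ → (refl , All.lookup (words-length r n) w∈) ∷ All.lookup (fillings-fit r rows) T∈

m*suc[n]∸m*n≡m : ∀ m n → m * suc n ∸ m * n ≡ m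
m*suc[n]∸m*n≡m m n = trans (cong (_∸ m * n) (*-suc m n)) (m+n∸n≡m m (m * n))

zip-[]ʳ : (xs : List A) → zip {B = B} xs [] ≡ []
zip-[]ʳ []       = refl
zip-[]ʳ (x ∷ xs) = refl

-- Consecutive offsets differ by t, the length of the lower row, so `drop` in `Above` removes that
-- whole row: no column meets both rows.
strip-columnStrict : ∀ {r} t n {T : Filling r} → Pointwise Fits (strip t n) T → ColumnStrict T
strip-columnStrict t zero          []       = []
strip-columnStrict t (suc zero)    (_ ∷ []) = [-]
strip-columnStrict t (suc (suc n)) {(_ , w) ∷ (_ , w′) ∷ _} ((refl , _) ∷ fit@((refl , len) ∷ _)) =
  subst (All _) (sym disjoint) [] ∷ strip-columnStrict t (suc n) fit
  where
  disjoint : zip w (drop (t * suc n ∸ t * n) w′) ≡ []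
  disjoint = trans (cong (zip w) (drop-all _ w′ (≤-reflexive (trans len (sym (m*suc[n]∸m*n≡m t n)))))) (zip-[]ʳ w)

strip-readingWord-length : ∀ {r} t n {T : Filling r} → Pointwise Fits (strip t n) T → length (readingWord T) ≡ n * t
strip-readingWord-length t zero    []                              = refl
strip-readingWord-length t (suc n) {(_ , w) ∷ T} ((_ , len) ∷ fit) = trans (length-++ (reverse w))
  (cong₂ _+_ (trans (length-reverse w) len) (strip-readingWord-length t n fit))

-- The final state gives #1 - #2 = e and the size gives #1 + #2 = e + 2q; together they are
-- equivalent to the content (e + q, q).
strip-isLR⇔good : ∀ t n e q {T} → e + q + q ≡ n * t → Pointwise Fits (strip t n) T →
  (IsLR (e + q ∷ q ∷ []) T → Good e 0 T) × (Good e 0 T → IsLR (e + q ∷ q ∷ []) T)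
strip-isLR⇔good t n e q {T} size fit = to , from
  where
  v = readingWord T
  total : count 0F v + count 1F v ≡ e + q + q
  total = trans (count-length v) (trans (strip-readingWord-length t n fit) (sym size))
  to : IsLR (e + q ∷ q ∷ []) T → Good e 0 T
  to ((weak , _) , content , ballot) =
    weak , ballot⇒walk v (All.map (λ le → le 0F 1F z<s) ballot)
      (trans (content 0F) (cong (λ x → e + x) (sym (content 1F))))
  from : Good e 0 T → IsLR (e + q ∷ q ∷ []) T
  from (weak , walk) = (weak , strip-columnStrict t n fit) , content , All.map (λ {u} → ordered u) (walk⇒ballot walk)
    where
    double : e + (count 1F v + count 1F v) ≡ e + (q + q)
    double = trans (sym (+-assoc e _ _)) (trans (cong (_+ count 1F v) (sym (walk⇒balance walk))) (trans total (+-assoc e q q)))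
    twos : count 1F v ≡ q
    twos = *-cancelˡ-≡ (count 1F v) q 2 (trans (two* (count 1F v)) (trans (+-cancelˡ-≡ e (count 1F v + count 1F v) (q + q) double) (sym (two* q))))
      where
      two* : ∀ x → 2 * x ≡ x + x
      two* x = cong (λ y → x + y) (+-identityʳ x)
    content : HasContent (e + q ∷ q ∷ []) T
    content 0F = trans (walk⇒balance walk) (cong (λ x → e + x) twos)
    content 1F = twos
    ordered : ∀ u → count 1F u ≤ count 0F u → ∀ (a b : Fin 2) → a Fin.< b → count b u ≤ count a u
    ordered u le 0F 0F ()
    ordered u le 0F 1F _ = le
    ordered u le 1F 0F ()
    ordered u le 1F 1F 1<1 = contradiction 1<1 (<-irrefl refl)

-- Staircases, t-binomial differences and the theorem

module _ (t : ℕ) .{{_ : NonZero t}} where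

  skewRows-staircase : ∀ n → skewRows (parts (t ⋆ staircase (suc n))) (parts (t ⋆ staircase n)) ≡ strip t (suc n)
  skewRows-staircase zero    = cong₂ (λ o k → (o , k) ∷ []) (sym (*-zeroʳ t)) (*-identityʳ t)
  skewRows-staircase (suc n) = cong₂ _∷_ (cong (t * suc n ,_) (m*suc[n]∸m*n≡m t (suc n))) (skewRows-staircase n)

  staircase-prefix : ∀ n → Prefix _≤_ (parts (t ⋆ staircase n)) (parts (t ⋆ staircase (suc n)))
  staircase-prefix zero    = []
  staircase-prefix (suc n) = *-monoʳ-≤ t (n≤1+n (suc n)) ∷ staircase-prefix n

  -- The skew shape is a strip of n + 1 rows, and e is the difference of the two parts of ν. An
  -- equation on `parts ν` is assumed because t(m + 1) equals t + tm only propositionally.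
  LR-staircase : ∀ n e q ν → parts ν ≡ e + q ∷ q ∷ [] → e + q + q ≡ suc n * t →
    + LR (t ⋆ staircase (suc n)) (t ⋆ staircase n) ν ≡ mult t e (suc n) 0ℤ
  LR-staircase n e q ν ν≡ size = begin
    + LR (t ⋆ staircase (suc n)) (t ⋆ staircase n) ν
      ≡⟨ cong (λ b → + (if b then total (parts ν) rows else 0))
           (trans (isYes≗does (prefix? _≤?_ _ _)) (dec-true (prefix? _≤?_ _ _) (staircase-prefix n))) ⟩
    + total (parts ν) rows
      ≡⟨ cong₂ (λ κ rs → + total κ rs) ν≡ (skewRows-staircase n) ⟩
    + total (e + q ∷ q ∷ []) (strip t (suc n))
      ≡⟨ cong +_ (length-filter-cong (isLR? (e + q ∷ q ∷ [])) (good? e 0)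
           (All.map (strip-isLR⇔good t (suc n) e q size) (fillings-fit 2 (strip t (suc n))))) ⟩
    + length (filter (good? e 0) (fillings 2 (strip t (suc n))))
      ≡⟨ count-good t e (suc n) 0 ⟩
    mult t e (suc n) 0ℤ ∎
    where
    open ≡-Reasoning
    rows = skewRows (parts (t ⋆ staircase (suc n))) (parts (t ⋆ staircase n))
    -- Abstracting over the content lets the alphabet `Fin (length κ)` change along with it under
    -- `cong₂`.
    total : List ℕ → List (ℕ × ℕ) → ℕ
    total κ rs = length (filter (isLR? κ) (fillings (length κ) rs))

-- After centring, k and k + 1 become the exponents e and e + 2, which are those of `mult` at d = 0.
tBinomial-mult : ∀ t n e k → k + k ≡ e + t * n →
  + tBinomial t n k - + tBinomial t n (suc k) ≡ mult t e n 0ℤ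
tBinomial-mult t n e k 2k≡ = cong₂ _-_
  (trans (tBinomial-coeff t n k) (cong (coeff t n) (trans
    (cong (λ z → + z - + (t * n)) 2k≡)
    (rearrange₁ (+ e) (+ (t * n))))))
  (trans (tBinomial-coeff t n (suc k)) (cong (coeff t n) (trans
    (cong (λ z → + z - + (t * n)) (cong suc (trans (+-suc k k) (cong suc 2k≡))))
    (rearrange₂ (+ e) (+ (t * n))))))
  where
  rearrange₁ : ∀ e m → e ℤ.+ m - m ≡ e - 0ℤ
  rearrange₁ = ℤ.solve-∀
  rearrange₂ : ∀ e m → + 2 ℤ.+ (e ℤ.+ m) - m ≡ e ℤ.+ 0ℤ ℤ.+ + 2
  rearrange₂ = ℤ.solve-∀

-- N_(n+1)(0) and N_(n+1)(2) sum N_n over the windows from -t to t and from 2 - t to t + 2 in steps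
-- of 2. The overlap cancels, leaving N_n(-t) - N_n(t + 2), and N_n is even. In representation
-- terms, this is the self-duality of V_t.
mult-dual : ∀ t n → mult t 0 (suc n) 0ℤ ≡ mult t t n 0ℤ
mult-dual t n = begin
  Σ< (suc t) h - (h′ 0 ℤ.+ Σ< t (h′ ∘ suc))
    ≡⟨ cong₂ (λ x y → x - (h′ 0 ℤ.+ y)) (Σ<-snoc t h)
         (Σ<-cong t λ a _ → cong (coeff t n) (rearrange₁ (+ t) (+ a))) ⟩
  Σ< t h ℤ.+ h t - (h′ 0 ℤ.+ Σ< t h)
    ≡⟨ telescope (Σ< t h) (h t) (h′ 0) ⟩
  h t - h′ 0
    ≡⟨ cong₂ _-_ (trans (cong (coeff t n) (rearrange₂ (+ t))) (coeff-neg t n _)) (cong (coeff t n) (rearrange₃ (+ t))) ⟩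
  mult t t n 0ℤ ∎
  where
  open ≡-Reasoning
  h h′ : ℕ → ℤ
  h  a = coeff t n (0ℤ ℤ.+ + t - (+ a ℤ.+ + a))
  h′ a = coeff t n (+ 2 ℤ.+ + t - (+ a ℤ.+ + a))
  rearrange₁ : ∀ t a → + 2 ℤ.+ t - (+ 1 ℤ.+ a ℤ.+ (+ 1 ℤ.+ a)) ≡ 0ℤ ℤ.+ t - (a ℤ.+ a)
  rearrange₁ = ℤ.solve-∀
  rearrange₂ : ∀ t → 0ℤ ℤ.+ t - (t ℤ.+ t) ≡ ℤ.- (t - 0ℤ)
  rearrange₂ = ℤ.solve-∀
  rearrange₃ : ∀ t → + 2 ℤ.+ t - 0ℤ ≡ t ℤ.+ 0ℤ ℤ.+ + 2
  rearrange₃ = ℤ.solve-∀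
  telescope : ∀ s x y → s ℤ.+ x - (y ℤ.+ s) ≡ x - y
  telescope = ℤ.solve-∀

theorem4 : ∀ (t m : ℕ) .{{_ : NonZero t}} .{{_ : NonZero m}} →
  let b₁ = + tBinomial t (1 + 2 * m) (t * (1 + m)) - + tBinomial t (1 + 2 * m) (1 + t * (1 + m))
      b₂ = + tBinomial t (2 + 2 * m) (t * (1 + m)) - + tBinomial t (2 + 2 * m) (1 + t * (1 + m))
      c₁ = LR (t ⋆ staircase (1 + 2 * m)) (t ⋆ staircase (2 * m)) (t ⋆ twoRow (1 + m) m (n≤1+n m))
      c₂ = LR (t ⋆ staircase (2 + 2 * m)) (t ⋆ staircase (1 + 2 * m)) (t ⋆ twoRow (1 + m) (1 + m) ≤-refl)
  in (b₁ ≡ b₂) × (c₁ ≡ c₂) × (b₁ ≡ + c₁) × (b₂ ≡ + c₂)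
theorem4 t m =
    trans b₁≡ (trans (sym dual) (sym b₂≡))
  , ℤ.+-injective (trans c₁≡ (trans (sym dual) (sym c₂≡)))
  , trans b₁≡ (sym c₁≡)
  , trans b₂≡ (sym c₂≡)
  where
  dual = mult-dual t (1 + 2 * m)
  size-b₁ : ∀ t m → t * (1 + m) + t * (1 + m) ≡ t + t * (1 + 2 * m)
  size-b₁ = ℕ.solve-∀
  size-b₂ : ∀ t m → t * (1 + m) + t * (1 + m) ≡ t * (2 + 2 * m)
  size-b₂ = ℕ.solve-∀
  size-c₁ : ∀ t m → t + t * m + t * m ≡ (1 + 2 * m) * t
  size-c₁ = ℕ.solve-∀
  size-c₂ : ∀ t m → t * (1 + m) + t * (1 + m) ≡ (2 + 2 * m) * t
  size-c₂ = ℕ.solve-∀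
  -- For 2m + 1 rows e = t: 2t(m + 1) exceeds t(2m + 1) by t, and the parts t(m + 1) and tm differ
  -- by t. For 2m + 2 rows both differences are 0.
  b₁≡ = tBinomial-mult t (1 + 2 * m) t (t * (1 + m)) (size-b₁ t m)
  b₂≡ = tBinomial-mult t (2 + 2 * m) 0 (t * (1 + m)) (size-b₂ t m)
  c₁≡ = LR-staircase t (2 * m) t (t * m) (t ⋆ twoRow (1 + m) m (n≤1+n m))
    (cong (_∷ t * m ∷ []) (*-suc t m)) (size-c₁ t m)
  c₂≡ = LR-staircase t (1 + 2 * m) 0 (t * (1 + m)) (t ⋆ twoRow (1 + m) (1 + m) ≤-refl)
    refl (size-c₂ t m)
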